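{- Let $g:\mathbb B^3\to\mathbb B$ be the Boolean function induced by the formula $v_1\wedge v_2\wedge v_3$, i.e. $g(b_1,b_2,b_3)=T$ iff $b_1=b_2=b_3=T$. There is no instruction sequence $X\in\mathrm{IS}^{na}_{br}$ such that: no jump instruction occurs in $X$, the termination instruction $!$ occurs at most once in $X$, the basic instruction $\mathrm{out}.\mathrm{set}{:}F$ does not occur in $X$ (in any plain, positive test or negative test instruction), and $X$ computes $g$.
   Context: $\mathbb B=\{T,F\}$. A primitive instruction is one of: a plain basic instruction $a$, a positive test instruction $+a$, a negative test instruction $-a$ (for a basic instruction $a$), a forward jump instruction $\#l$ ($l\in\mathbb N$), or the termination instruction $!$. An instruction sequence is a finite nonempty sequence $X=u_1;\dots;u_k$ of primitive instructions; its length is $|X|=k$. Basic instructions have the form $f.m$ where the focus $f$ is one of $\mathrm{in}{:}i$, $\mathrm{aux}{:}i$ ($i\ge 1$) or $\mathrm{out}$, each naming a Boolean register, and the method $m$ is one of $\mathrm{set}{:}T$, $\mathrm{set}{:}F$, $\mathrm{get}$. Executing $f.\mathrm{set}{:}b$ sets register $f$ to $b$ and yields reply $b$; executing $f.\mathrm{get}$ leaves the register unchanged and yields its content as reply. Execution of $X=u_1;\dots;u_k$: a counter starts at $1$. If the counter exceeds $k$, execution deadlocks. At position $i$: if $u_i=!$, execution terminates; if $u_i=\#l$, execution deadlocks if $l=0$ and otherwise the counter becomes $i+l$; if $u_i$ is $a$, $+a$ or $-a$, the basic instruction $a$ is executed yielding reply $r$, and the counter becomes $i+1$ for $u_i=a$;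 for $u_i=+a$ it becomes $i+1$ if $r=T$ and $i+2$ if $r=F$; for $u_i=-a$ it becomes $i+1$ if $r=F$ and $i+2$ if $r=T$. $\mathrm{IS}_{br}$ is the set of instruction sequences in which every basic instruction occurring belongs to $\{f.\mathrm{get}: f=\mathrm{in}{:}i \text{ or } f=\mathrm{aux}{:}i\}\cup\{f.\mathrm{set}{:}b: f=\mathrm{aux}{:}i \text{ or } f=\mathrm{out},\ b\in\mathbb B\}$. $\mathrm{IS}^{na}_{br}\subseteq \mathrm{IS}_{br}$ is the set of those in which every basic instruction belongs to $\{\mathrm{in}{:}i.\mathrm{get}: i\ge1\}\cup\{\mathrm{out}.\mathrm{set}{:}T,\mathrm{out}.\mathrm{set}{:}F\}$. $X\in\mathrm{IS}_{br}$ computes $f:\mathbb B^n\to\mathbb B$ if for every $(b_1,\dots,b_n)\in\mathbb B^n$: when $X$ is executed with register $\mathrm{in}{:}j$ initialised to $b_j$ ($j\le n$) and all registers $\mathrm{aux}{:}i$ and $\mathrm{out}$ initialised to $F$, execution terminates (does not deadlock) without ever executing a basic instruction with focus $\mathrm{in}{:}j$ for $j>n$, and at termination register $\mathrm{out}$ contains $f(b_1,\dots,b_n)$. -}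

module Defs where

open import Data.Bool.Base using (Bool; true; false; _∧_; if_then_else_)
open import Data.Fin.Base using (Fin; toℕ)
open import Data.List.Base using (drop; head)
open import Data.List.NonEmpty.Base using (List⁺; toList)
open import Data.List.Relation.Unary.Any using (Any)
open import Data.List.Membership.Propositional using (_∈_)
open import Data.Maybe.Base using (Maybe; just; nothing)
open import Data.Nat.Base using (ℕ; zero; suc; _+_; _≤_; NonZero)
import Data.Nat.Properties as ℕ
open import Data.Product.Base using (_×_; _,_; ∃-syntax)
open import Data.Vec.Base using (Vec; []; _∷_; lookup)
open import Relation.Binary.Construct.Closure.ReflexiveTransitive using (Star)
open import Relation.Binary.Definitions using (DecidableEquality)
open import Relation.Binary.PropositionalEquality.Core using (_≡_; refl)
open import Relation.Nullary.Decidable.Core using (yes; no; does)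
open import Relation.Nullary.Negation.Core using (¬_)
open import Relation.Unary using (Pred; _∩_)
open import Level using (0ℓ)

infix  9 in:_ aux:_
infix  8 _∙_
infix  7 +_ -_ #_
infix  4 _≟_ _OccursIn_ _⊢_⟶_ _⊢_⟶*_ _Computes_

-- `true` and `false` are the truth values T and F.

data Focus : Set where
  in:_  : (i : ℕ) .{{_ : NonZero i}} → Focus
  aux:_ : (i : ℕ) .{{_ : NonZero i}} → Focus
  out   : Focus

_≟_ : DecidableEquality Focus
in: i  ≟ in: j with i ℕ.≟ j
... | yes refl = yes refl
... | no  i≢j  = no λ { refl → i≢j refl }
in: _  ≟ aux: _ = no λ ()
in: _  ≟ out    = no λ ()
aux: _ ≟ in: _  = no λ ()
aux: i ≟ aux: j with i ℕ.≟ j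
... | yes refl = yes refl
... | no  i≢j  = no λ { refl → i≢j refl }
aux: _ ≟ out    = no λ ()
out    ≟ in: _  = no λ ()
out    ≟ aux: _ = no λ ()
out    ≟ out    = yes refl

data Method : Set where
  set:_ : Bool → Method
  get   : Method

-- The basic instruction written f.m in the literature is  f ∙ m.
record Basic : Set where
  constructor _∙_
  field
    focus  : Focus
    method : Method

data Instruction : Set where
  plain : Basic → Instruction
  +_    : Basic → Instruction
  -_    : Basic → Instruction
  #_    : ℕ → Instruction
  !     : Instruction

InstructionSequence : Set
InstructionSequence = List⁺ Instruction

-- Positions are counted from 1; there is no instruction at position 0.
fetch : InstructionSequence → ℕ → Maybe Instruction
fetch X zero    = nothing
fetch X (suc i) = head (drop i (toList X))

data Contains (a : Basic) : Instruction → Set where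
  plain    : Contains a (plain a)
  positive : Contains a (+ a)
  negative : Contains a (- a)

_OccursIn_ : Basic → InstructionSequence → Set
a OccursIn X = Any (Contains a) (toList X)

data BrBasic : Pred Basic 0ℓ where
  in-get  : ∀ i .{{_ : NonZero i}} → BrBasic (in: i ∙ get)
  aux-get : ∀ i .{{_ : NonZero i}} → BrBasic (aux: i ∙ get)
  aux-set : ∀ i b .{{_ : NonZero i}} → BrBasic (aux: i ∙ set: b)
  out-set : ∀ b → BrBasic (out ∙ set: b)

data BrNaBasic : Pred Basic 0ℓ where
  in-get  : ∀ i .{{_ : NonZero i}} → BrNaBasic (in: i ∙ get)
  out-set : ∀ b → BrNaBasic (out ∙ set: b)

IS-br : Pred InstructionSequence 0ℓ
IS-br X = ∀ a → a OccursIn X → BrBasic a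

IS-br-na : Pred InstructionSequence 0ℓ
IS-br-na = IS-br ∩ λ X → ∀ a → a OccursIn X → BrNaBasic a

State : Set
State = Focus → Bool

_[_≔_] : State → Focus → Bool → State
(s [ f ≔ b ]) g = if does (g ≟ f) then b else s g

reply : Basic → State → Bool
reply (f ∙ set: b) s = b
reply (f ∙ get)    s = s f

effect : Basic → State → State
effect (f ∙ set: b) s = s [ f ≔ b ]
effect (f ∙ get)    s = s

-- The instruction counter together with the contents of the registers.
Config : Set
Config = ℕ × State

-- A configuration that neither has a successor nor is terminated is
-- deadlocked: the counter is past the end, or it is at  # 0.
data _⊢_⟶_ (X : InstructionSequence) : Config → Config → Set where
  plain    : ∀ {i s a} → fetch X i ≡ just (plain a) →
             X ⊢ (i , s) ⟶ (i + 1 , effect a s)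
  positive : ∀ {i s a} → fetch X i ≡ just (+ a) →
             X ⊢ (i , s) ⟶ ((if reply a s then i + 1 else i + 2) , effect a s)
  negative : ∀ {i s a} → fetch X i ≡ just (- a) →
             X ⊢ (i , s) ⟶ ((if reply a s then i + 2 else i + 1) , effect a s)
  jump     : ∀ {i s l} .{{_ : NonZero l}} → fetch X i ≡ just (# l) →
             X ⊢ (i , s) ⟶ (i + l , s)

_⊢_⟶*_ : InstructionSequence → Config → Config → Set
X ⊢ c ⟶* d = Star (X ⊢_⟶_) c d

-- The registers in:j with j > n are left unconstrained.
record Initial {n} (bs : Vec Bool n) (s : State) : Set where
  field
    inputs      : (j : Fin n) → s (in: suc (toℕ j)) ≡ lookup bs j
    auxiliaries : ∀ i .{{_ : NonZero i}} → s (aux: i) ≡ false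
    output      : s out ≡ false

TerminatesWith : InstructionSequence → State → Bool → Set
TerminatesWith X s b =
  ∃[ i ] ∃[ t ] (X ⊢ (1 , s) ⟶* (i , t)) × fetch X i ≡ just ! × t out ≡ b

UsesOnlyInputsUpTo : ℕ → InstructionSequence → State → Set
UsesOnlyInputsUpTo n X s =
  ∀ {i t u} → X ⊢ (1 , s) ⟶* (i , t) → fetch X i ≡ just u →
  ∀ j m .{{_ : NonZero j}} → Contains (in: j ∙ m) u → j ≤ n

_Computes_ : ∀ {n} → InstructionSequence → (Vec Bool n → Bool) → Set
_Computes_ {n} X f =
  ∀ bs s → Initial bs s → TerminatesWith X s (f bs) × UsesOnlyInputsUpTo n X s

NoJump : InstructionSequence → Set
NoJump X = ∀ l → ¬ (# l ∈ toList X)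

AtMostOneTermination : InstructionSequence → Set
AtMostOneTermination X =
  ∀ i j → fetch X i ≡ just ! → fetch X j ≡ just ! → i ≡ j

and₃ : Vec Bool 3 → Bool
and₃ (v₁ ∷ v₂ ∷ v₃ ∷ []) = v₁ ∧ v₂ ∧ v₃

-- If the input TTT makes the output true, its execution passes a position q
-- holding out.set:T, which lies before the only termination instruction.
-- Every other input must reach that instruction without executing position q,
-- and since the counter advances by at most two, it must skip q from q ∸ 1.
-- So position q ∸ 1 holds a test of some in:i that skips both when all inputs are
-- F and when in:i is the only input that is T, which is impossible.

module Submission where

open import Defs
open import Data.Bool.Base using (Bool; true; false; not; if_then_else_)
open import Data.Bool.Properties using (if-not)
open import Data.Empty using (⊥)
open import Data.Fin.Base using (toℕ)
open import Data.List.Base using (List; _∷_; drop; head)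
open import Data.List.Membership.Propositional using (_∈_; lose)
open import Data.List.NonEmpty.Base using (toList)
open import Data.List.Relation.Unary.Any using (here; there)
open import Data.Maybe.Base using (just)
open import Data.Nat.Base using (ℕ; zero; suc; _+_; _≤_; _<_; s≤s⁻¹; z<s; NonZero)
open import Data.Nat.Properties
  using (≤-refl; ≤-trans; ≤-antisym; <⇒≤; ≤⇒≯; ≰⇒>; m<m+n; m≤n⇒m<n∨m≡n; +-comm; _≤?_)
open import Data.Product.Base using (_×_; _,_; ∃-syntax; proj₁)
open import Data.Sum.Base using (_⊎_; inj₁; inj₂)
open import Data.Vec.Base using (Vec; tabulate)
open import Data.Vec.Properties using (lookup∘tabulate)
open import Relation.Binary.Construct.Closure.ReflexiveTransitive using (ε; _◅_)
open import Relation.Binary.PropositionalEquality.Core using (_≡_; refl; sym; trans; cong; subst)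
open import Relation.Nullary.Decidable using (yes; no; dec-true)
open import Relation.Nullary.Negation.Core using (¬_; contradiction)

head-drop-∈ : ∀ {A : Set} (xs : List A) i {x} → head (drop i xs) ≡ just x → x ∈ xs
head-drop-∈ (x ∷ xs) zero    refl = here refl
head-drop-∈ (x ∷ xs) (suc i) eq   = there (head-drop-∈ xs i eq)

fetch-∈ : ∀ X i {u} → fetch X i ≡ just u → u ∈ toList X
fetch-∈ X (suc i) = head-drop-∈ (toList X) i

skips : ∀ {a u} → Contains a u → State → Bool
skips     plain    s = false
skips {a} positive s = not (reply a s)
skips {a} negative s = reply a s

-- Plain instructions and both kinds of test share this form and differ only in `skip`. Without
-- jumps every step has it, so an induction on a run needs no case for the kind of instruction.
record BasicStep (X : InstructionSequence) (i : ℕ) (s : State) : Set where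
  field
    {instruction} : Instruction
    {basic}       : Basic
    fetched       : fetch X i ≡ just instruction
    contains      : Contains basic instruction

  skip : Bool
  skip = skips contains s

  next : ℕ
  next = if skip then i + 2 else i + 1

  result : State
  result = effect basic s

open BasicStep

basicStep : ∀ {X i s j t} → NoJump X → X ⊢ (i , s) ⟶ (j , t) →
            ∃[ b ] j ≡ next {X} {i} {s} b × t ≡ result b
basicStep nj (plain e) = record { fetched = e ; contains = plain } , refl , refl
-- A positive test skips on reply F, so `skip` negates the reply and the branches of the conditional
-- swap.
basicStep {s = s} nj (positive {a = a} e) =
  record { fetched = e ; contains = positive } , sym (if-not (reply a s)) , refl
basicStep nj (negative e) = record { fetched = e ; contains = negative } , refl , refl
basicStep {X} {i} nj (jump e) = contradiction (fetch-∈ X i e) (nj _)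

data InGetOrOutSetTrue : Basic → Set where
  in-get       : ∀ i .{{_ : NonZero i}} → InGetOrOutSetTrue (in: i ∙ get)
  out-set-true : InGetOrOutSetTrue (out ∙ set: true)

effect-in : ∀ {a} → InGetOrOutSetTrue a → ∀ s i .{{_ : NonZero i}} →
            effect a s (in: i) ≡ s (in: i)
effect-in (in-get _)   s i = refl
effect-in out-set-true s i = refl

effect-out-true : ∀ {a} → InGetOrOutSetTrue a → ∀ s → s out ≡ true → effect a s out ≡ true
effect-out-true (in-get _)   s o = o
effect-out-true out-set-true s o = refl

next-increases : ∀ {X i s} (b : BasicStep X i s) → i < next b
next-increases {i = i} b with skip b
... | true  = m<m+n i z<s
... | false = m<m+n i z<s

-- An advance of one leaves no position strictly in between, and an advance of two leaves exactly
-- one.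
next-jumps-over : ∀ {X i s q} (b : BasicStep X i s) → i < q → q < next b → skip b ≡ true × q ≡ suc i
next-jumps-over {i = i} {q = q} b i<q q<n with skip b
... | true  = refl , ≤-antisym (s≤s⁻¹ (subst (q <_) (+-comm i 2) q<n)) i<q
... | false = contradiction (subst (q <_) (+-comm i 1) q<n) (≤⇒≯ i<q)

all-false : State
all-false _ = false

-- Since in:i is unconstrained initially for i > 3, this serves for every i, so that
-- the restriction to the first three inputs is never needed.
only : ∀ i .{{_ : NonZero i}} → State
only i = all-false [ in: i ≔ true ]

inputs₃ : State → Vec Bool 3
inputs₃ s = tabulate λ j → s (in: suc (toℕ j))

initial₃ : ∀ {s} → (∀ i .{{_ : NonZero i}} → s (aux: i) ≡ false) → s out ≡ false → Initial (inputs₃ s) s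
initial₃ {s} a o = record
  { inputs = λ j → sym (lookup∘tabulate (λ j → s (in: suc (toℕ j))) j) ; auxiliaries = a ; output = o }

-- For `i` equal to 1 the second input is F; for any larger `i` the first one is.
and₃-only : ∀ i .{{_ : NonZero i}} → and₃ (inputs₃ (only i)) ≡ false
and₃-only 1 = refl
and₃-only (suc (suc i)) = refl

only-true : ∀ i .{{_ : NonZero i}} → only i (in: i) ≡ true
only-true i rewrite dec-true (in: i ≟ in: i) refl = refl

module _ {X : InstructionSequence} (noJump : NoJump X)
         (allowed : ∀ a → a OccursIn X → InGetOrOutSetTrue a) where

  basic-allowed : ∀ {i s} (b : BasicStep X i s) → InGetOrOutSetTrue (basic b)
  basic-allowed {i} b = allowed _ (lose (fetch-∈ X i (fetched b)) (contains b))

  out-true-persists : ∀ {i s p t} → X ⊢ (i , s) ⟶* (p , t) → s out ≡ true → t out ≡ true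
  out-true-persists ε o = o
  out-true-persists {s = s} (st ◅ sts) o with basicStep noJump st
  ... | b , refl , refl = out-true-persists sts (effect-out-true (basic-allowed b) s o)

  counter-increases : ∀ {i s p t} → X ⊢ (i , s) ⟶* (p , t) → i ≤ p
  counter-increases ε = ≤-refl
  counter-increases (st ◅ sts) with basicStep noJump st
  ... | b , refl , refl = ≤-trans (<⇒≤ (next-increases b)) (counter-increases sts)

  SetsOut : ℕ → Set
  SetsOut q = ∃[ u ] fetch X q ≡ just u × Contains (out ∙ set: true) u

  sets-or-keeps-out : ∀ {i s} (b : BasicStep X i s) → SetsOut i ⊎ result b out ≡ s out
  sets-or-keeps-out b with basic b | contains b | fetched b | basic-allowed b
  ... | _ | c | e | out-set-true = inj₁ (_ , e , c)
  ... | _ | _ | _ | in-get _     = inj₂ refl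

  -- Some step must change `out`, and only `out ∙ set: true` can. The counter strictly increases at
  -- that step and never decreases afterwards, which puts `q` before `p`.
  setter-executed : ∀ {i s p t} → X ⊢ (i , s) ⟶* (p , t) → s out ≡ false → t out ≡ true →
                    ∃[ q ] i ≤ q × q < p × SetsOut q
  setter-executed ε s-out t-out = contradiction (trans (sym s-out) t-out) λ ()
  setter-executed {i} (st ◅ sts) s-out t-out with basicStep noJump st
  ... | b , refl , refl with sets-or-keeps-out b
  ... | inj₁ sets = i , ≤-refl , ≤-trans (next-increases b) (counter-increases sts) , sets
  ... | inj₂ keeps with setter-executed sts (trans keeps s-out) t-out
  ...   | q , n≤q , rest = q , ≤-trans (<⇒≤ (next-increases b)) n≤q , rest

  -- A position holds at most one instruction, so a step taken at `q` executes the setter found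
  -- there.
  set-by-setter : ∀ {q s} → SetsOut q → (b : BasicStep X q s) → result b out ≡ true
  set-by-setter (u , e , c) record { fetched = e′ ; contains = c′ } with trans (sym e) e′
  set-by-setter (_ , _ , plain)    record { contains = plain }    | refl = refl
  set-by-setter (_ , _ , positive) record { contains = positive } | refl = refl
  set-by-setter (_ , _ , negative) record { contains = negative } | refl = refl

  -- The field `inputs` ties the reply of the skipping test to the initial input. The field `unset`
  -- excludes the test `- (out ∙ set: true)`, which also skips but makes the output T.
  record SkippedOver (q : ℕ) (s : State) : Set where
    field
      {position} : ℕ
      {state}    : State
      precedes   : q ≡ suc position
      inputs     : ∀ i .{{_ : NonZero i}} → state (in: i) ≡ s (in: i)
      step       : BasicStep X position state
      skipping   : skip step ≡ true
      unset      : ¬ (result step out ≡ true)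

  -- The run starts at or before `q` and ends beyond it, so some step leaves a position at or before
  -- `q` for one after it. That step is the one sought.
  setter-skipped : ∀ {i s p t q} → X ⊢ (i , s) ⟶* (p , t) → t out ≡ false →
                   SetsOut q → i ≤ q → q < p → SkippedOver q s
  setter-skipped ε t-out sets i≤q q<p = contradiction q<p (≤⇒≯ i≤q)
  setter-skipped {s = s} {q = q} (st ◅ sts) t-out sets i≤q q<p with basicStep noJump st
  ... | b , refl , refl with m≤n⇒m<n∨m≡n i≤q
  -- Executing `q` itself would make `out` T, and it would stay T until the end.
  ...   | inj₂ refl =
    contradiction (trans (sym t-out) (out-true-persists sts (set-by-setter sets b))) λ ()
  ...   | inj₁ i<q with next b ≤? q
  ...     | yes n≤q = record
    { precedes = precedes
    ; inputs   = λ i → trans (inputs i) (effect-in (basic-allowed b) s i)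
    ; step     = step
    ; skipping = skipping
    ; unset    = unset
    }
    where open SkippedOver (setter-skipped sts t-out sets n≤q q<p)
  ...     | no n≰q with next-jumps-over b i<q (≰⇒> n≰q)
  ...       | skipping , precedes = record
    { precedes = precedes
    ; inputs   = λ _ → refl
    ; step     = b
    ; skipping = skipping
    ; unset    = λ o → contradiction (trans (sym t-out) (out-true-persists sts o)) λ ()
    }

  -- The skip would have to come from this very test at `k`, but its input is still T, so the reply
  -- is T and it moves on to the next position.
  true-get-not-skipped : ∀ {k s i} .{{_ : NonZero i}} → fetch X k ≡ just (+ (in: i ∙ get)) →
                         s (in: i) ≡ true → ¬ SkippedOver (suc k) s
  true-get-not-skipped {i = i} e s-true record { precedes = refl ; inputs = inputs ; step = b ; skipping = sk }
    with contains b | trans (sym e) (fetched b)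
  ... | positive | refl = contradiction (trans (sym sk) (cong not (trans (inputs i) s-true))) λ ()

  -- The run on all F leaves only a positive test of some input before `q`. Which input is known
  -- only then, so the second hypothesis ranges over every `i`.
  all-skipped-impossible : ∀ {q} → SkippedOver q all-false →
                           ¬ (∀ i .{{_ : NonZero i}} → SkippedOver q (only i))
  all-skipped-impossible record { precedes = refl ; inputs = inputs ; step = b ; skipping = sk ; unset = unset } skipped
    with basic b | contains b | fetched b | basic-allowed b
  ... | _ | _        | _ | out-set-true = contradiction refl unset
  ... | _ | plain    | _ | in-get i = contradiction sk λ ()
  ... | _ | negative | _ | in-get i = contradiction (trans (sym sk) (inputs i)) λ ()
  ... | _ | positive | e | in-get i = true-get-not-skipped e (only-true i) (skipped i)

theorem3 : ¬ (∃[ X ] (IS-br-na X × NoJump X × AtMostOneTermination X × ¬ ((out ∙ set: false) OccursIn X) × X Computes and₃))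
theorem3 (X , (_ , na) , noJump , unique! , no-out-set-false , computes) = contra
  where
  allowed : ∀ a → a OccursIn X → InGetOrOutSetTrue a
  allowed a occ with na a occ
  ... | in-get i      = in-get i
  ... | out-set true  = out-set-true
  ... | out-set false = contradiction occ no-out-set-false

  all-true : State
  all-true = λ { (in: _) → true ; _ → false }

  terminates : ∀ s → (∀ i .{{_ : NonZero i}} → s (aux: i) ≡ false) → s out ≡ false →
               TerminatesWith X s (and₃ (inputs₃ s))
  terminates s a o = proj₁ (computes (inputs₃ s) s (initial₃ a o))

  contra : ⊥
  contra with terminates all-true (λ _ → refl) refl
  ... | p , _ , run , p! , t-out with setter-executed noJump allowed run refl t-out
  ... | q , 1≤q , q<p , sets = all-skipped-impossible noJump allowed
    (skipped all-false (λ _ → refl) refl refl)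
    (λ i → skipped (only i) (λ _ → refl) refl (and₃-only i))
    where
    skipped : ∀ s → (∀ i .{{_ : NonZero i}} → s (aux: i) ≡ false) → s out ≡ false →
              and₃ (inputs₃ s) ≡ false → SkippedOver noJump allowed q s
    skipped s a o f with terminates s a o
    -- Uniqueness of the termination instruction makes this run end at the same `p`, hence also
    -- beyond `q`.
    ... | p′ , _ , run′ , p′! , t-out′ with unique! p′ p p′! p!
    ... | refl = setter-skipped noJump allowed run′ (trans t-out′ f) sets 1≤q q<p
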